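{- Let $G$ be a countably infinite discrete group, let $X$ be an aperiodic Borel $G$-space and let $E$ be a smooth $G$-invariant equivalence relation on $X$. There exists a partition $\mathcal P$ of $X$ into $4$ Borel sets such that $G\mathcal P=\{gP: g\in G, P\in\mathcal P\}$ separates any two $E$-nonequivalent points of $X$; that is, for all $x,y\in X$ that are not $E$-equivalent there are $g\in G$ and $P\in\mathcal P$ such that exactly one of $x,y$ belongs to $gP$.
   Context: A Borel $G$-space is a standard Borel space $X$ equipped with a Borel action of $G$; it is aperiodic if every orbit is infinite. An equivalence relation $E$ on $X$ is smooth if there is a Borel map $h:X\to\mathbb{R}$ such that for all $x,y\in X$, $xEy \iff h(x)=h(y)$. $E$ is $G$-invariant if any two points in the same $G$-orbit are $E$-equivalent (each $E$-class is a union of $G$-orbits). Pieces of a partition are allowed to be empty. -}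

module Defs where

open import Algebra.Bundles using (Group)
open import Data.Fin.Base using (Fin)
import Data.List.Membership.Setoid as Membership
open import Data.Maybe.Base using (Maybe; just)
open import Data.Nat.Base as ℕ using (ℕ)
open import Data.Product.Base using (Σ-syntax; ∃-syntax; ∃₂; _×_; _,_; uncurry)
open import Data.Product.Relation.Binary.Pointwise.NonDependent using (_×ₛ_)
open import Data.Rational.Base as ℚ using (ℚ; 0ℚ; 1ℚ)
import Data.Rational.Properties as ℚₚ
open import Data.Sum.Base using (_⊎_)
open import Function.Base using (_∘_; id)
open import Function.Bundles using (Bijection; _⇔_)
open import Function.Metric.Core using (DistanceFunction)
open import Function.Metric.Structures using (IsGeneralMetric)
open import Level using (Level; _⊔_; suc; 0ℓ)
open import Relation.Binary.Bundles using (Setoid)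
open import Relation.Binary.Core using (Rel)
open import Relation.Binary.Definitions using (_Respects_; tri<; tri≈; tri>)
open import Relation.Binary.PropositionalEquality as ≡ using (_≡_; refl)
import Relation.Binary.PropositionalEquality.Properties as ≡ₚ
open import Relation.Nullary.Negation.Core using (¬_; contradiction)
open import Relation.Unary using (Pred; _∈_; _∉_; _⊆_; _≐_; ∅; ∁; ⋃; _⊢_; _⟨×⟩_)

private
  variable
    a b c ℓ ℓ₁ ℓ₂ m m₁ m₂ g e p : Level

------------------------------------------------------------------------
-- Real numbers

-- Dedekind's (classical, one-sided) cuts: a real is the set of rationals
-- strictly below it.  No locatedness is required, because the theorem is
-- stated under excluded middle.

record ℝ : Set₁ where
  field
    lower     : Pred ℚ 0ℓ
    inhabited : ∃[ q ] q ∈ lower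
    proper    : ∃[ q ] q ∉ lower
    downward  : ∀ {q r} → q ℚ.< r → r ∈ lower → q ∈ lower
    no-max    : ∀ {q} → q ∈ lower → ∃[ r ] q ℚ.< r × r ∈ lower

open ℝ public

infix 4 _≤ℝ_ _<ℝ_ _≃_
infixl 6 _+ℝ_

_≤ℝ_ : Rel ℝ 0ℓ
x ≤ℝ y = lower x ⊆ lower y

_<ℝ_ : Rel ℝ 0ℓ
x <ℝ y = ∃[ q ] q ∉ lower x × q ∈ lower y

_≃_ : Rel ℝ 0ℓ
x ≃ y = lower x ≐ lower y

ℝ-setoid : Setoid (suc 0ℓ) 0ℓ
ℝ-setoid = record
  { Carrier = ℝ
  ; _≈_ = _≃_
  ; isEquivalence = record
    { refl  = id , id
    ; sym   = λ (f , g) → g , f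
    ; trans = λ (f , f′) (g , g′) → g ∘ f , f′ ∘ g′
    }
  }

private
  minus-plus : ∀ t s → t ≡ (t ℚ.- s) ℚ.+ s
  minus-plus t s = ≡.sym (≡.trans (ℚₚ.+-assoc t (ℚ.- s) s)
    (≡.trans (≡.cong (t ℚ.+_) (ℚₚ.+-inverseˡ s)) (ℚₚ.+-identityʳ t)))

  plus-minus : ∀ r s → (r ℚ.+ s) ℚ.- s ≡ r
  plus-minus r s = ≡.trans (ℚₚ.+-assoc r s (ℚ.- s))
    (≡.trans (≡.cong (r ℚ.+_) (ℚₚ.+-inverseʳ s)) (ℚₚ.+-identityʳ r))

  below-non-member : ∀ (x : ℝ) {q r} → q ∉ lower x → r ∈ lower x → r ℚ.< q
  below-non-member x {q} {r} q∉x r∈x with ℚₚ.<-cmp r q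
  ... | tri< r<q _ _  = r<q
  ... | tri≈ _ refl _ = contradiction r∈x q∉x
  ... | tri> _ _ q<r  = contradiction (downward x q<r r∈x) q∉x

0ℝ : ℝ
0ℝ = record
  { lower     = ℚ._< 0ℚ
  ; inhabited = ℚ.- 1ℚ , ℚₚ.negative⁻¹ (ℚ.- 1ℚ)
  ; proper    = 0ℚ , ℚₚ.<-irrefl refl
  ; downward  = ℚₚ.<-trans
  ; no-max    = ℚₚ.<-dense
  }

_+ℝ_ : ℝ → ℝ → ℝ
x +ℝ y = record
  { lower     = λ t → ∃₂ λ r s → r ∈ lower x × s ∈ lower y × t ≡ r ℚ.+ s
  ; inhabited =
      let (r , r∈x) = inhabited x; (s , s∈y) = inhabited y
      in r ℚ.+ s , r , s , r∈x , s∈y , refl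
  ; proper    =
      let (q , q∉x) = proper x; (q′ , q′∉y) = proper y
      in q ℚ.+ q′ , λ (r , s , r∈x , s∈y , eq) →
           ℚₚ.<-irrefl (≡.sym eq)
             (ℚₚ.+-mono-< (below-non-member x q∉x r∈x) (below-non-member y q′∉y s∈y))
  ; downward  = λ { {q} q<t (r , s , r∈x , s∈y , refl) →
      q ℚ.- s , s
      , downward x (≡.subst (q ℚ.- s ℚ.<_) (plus-minus r s) (ℚₚ.+-monoˡ-< (ℚ.- s) q<t)) r∈x
      , s∈y
      , minus-plus q s }
  ; no-max    = λ { (r , s , r∈x , s∈y , refl) →
      let (r′ , r<r′ , r′∈x) = no-max x r∈x
      in r′ ℚ.+ s , ℚₚ.+-monoˡ-< s r<r′ , r′ , s , r′∈x , s∈y , refl }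
  }

------------------------------------------------------------------------
-- Measurable spaces
--
-- Sets are setoids.  Subsets take values in Set₀; under excluded middle
-- this is no restriction.

data Generated {A : Set a} (𝒢 : Pred (Pred A 0ℓ) g) :
               Pred (Pred A 0ℓ) (suc 0ℓ ⊔ a ⊔ g) where
  basic  : ∀ {S} → S ∈ 𝒢 → S ∈ Generated 𝒢
  empty  : ∅ ∈ Generated 𝒢
  compl  : ∀ {S} → S ∈ Generated 𝒢 → ∁ S ∈ Generated 𝒢
  union  : ∀ {S : ℕ → Pred A 0ℓ} → (∀ n → S n ∈ Generated 𝒢) → ⋃ ℕ S ∈ Generated 𝒢
  resp-≐ : ∀ {S T} → S ≐ T → S ∈ Generated 𝒢 → T ∈ Generated 𝒢

record MeasurableSpace (a ℓ m : Level) : Set (suc (a ⊔ ℓ ⊔ m)) where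
  field
    setoid : Setoid a ℓ

  open Setoid setoid public using (Carrier; _≈_)

  field
    Measurable : Pred (Pred Carrier 0ℓ) m
    respects   : ∀ {S} → Measurable S → S Respects _≈_
    extensional : ∀ {S T} → S ≐ T → Measurable S → Measurable T
    ∅-measurable : Measurable ∅
    ∁-measurable : ∀ {S} → Measurable S → Measurable (∁ S)
    ⋃-measurable : ∀ {S : ℕ → Pred Carrier 0ℓ} → (∀ n → Measurable (S n)) → Measurable (⋃ ℕ S)

generate : (X : Setoid a ℓ) (let open Setoid X) (𝒢 : Pred (Pred Carrier 0ℓ) g) →
           (∀ {S} → S ∈ 𝒢 → S Respects _≈_) →
           MeasurableSpace a ℓ (suc 0ℓ ⊔ a ⊔ g)
generate X 𝒢 𝒢-resp = record
  { setoid       = X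
  ; Measurable   = Generated 𝒢
  ; respects     = resp
  ; extensional  = resp-≐
  ; ∅-measurable = empty
  ; ∁-measurable = compl
  ; ⋃-measurable = union
  }
  where
  open Setoid X
  resp : ∀ {S} → S ∈ Generated 𝒢 → S Respects _≈_
  resp (basic S∈𝒢)           x≈y Sx       = 𝒢-resp S∈𝒢 x≈y Sx
  resp empty                 x≈y ()
  resp (compl S)             x≈y ¬Sx Sy   = ¬Sx (resp S (sym x≈y) Sy)
  resp (union S)             x≈y (n , Sx) = n , resp (S n) x≈y Sx
  resp (resp-≐ (S⊆T , T⊆S) S) x≈y Tx      = S⊆T (resp S x≈y (T⊆S Tx))

discrete : Setoid a ℓ → MeasurableSpace a ℓ (a ⊔ ℓ)
discrete X = record
  { setoid       = X
  ; Measurable   = _Respects _≈_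
  ; respects     = id
  ; extensional  = λ (S⊆T , T⊆S) resp x≈y Tx → S⊆T (resp x≈y (T⊆S Tx))
  ; ∅-measurable = λ _ ()
  ; ∁-measurable = λ resp x≈y ¬Sx Sy → ¬Sx (resp (sym x≈y) Sy)
  ; ⋃-measurable = λ resp x≈y (n , Sx) → n , resp n x≈y Sx
  }
  where open Setoid X

_⊗_ : MeasurableSpace a ℓ₁ m₁ → MeasurableSpace b ℓ₂ m₂ →
      MeasurableSpace (a ⊔ b) (ℓ₁ ⊔ ℓ₂) (suc 0ℓ ⊔ a ⊔ b ⊔ m₁ ⊔ m₂)
M ⊗ N = generate (M.setoid ×ₛ N.setoid)
  (λ W → ∃₂ λ S T → M.Measurable S × N.Measurable T × W ≐ (S ⟨×⟩ T))
  λ (S , T , mS , mT , W⊆S×T , S×T⊆W) (x≈x′ , y≈y′) W →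
    let (Sx , Ty) = W⊆S×T W
    in S×T⊆W (M.respects mS x≈x′ Sx , N.respects mT y≈y′ Ty)
  where
  module M = MeasurableSpace M
  module N = MeasurableSpace N

record IsMeasurableMap (M : MeasurableSpace a ℓ₁ m₁) (N : MeasurableSpace b ℓ₂ m₂)
                       (f : MeasurableSpace.Carrier M → MeasurableSpace.Carrier N) :
                       Set (suc 0ℓ ⊔ a ⊔ b ⊔ ℓ₁ ⊔ ℓ₂ ⊔ m₁ ⊔ m₂) where
  private
    module M = MeasurableSpace M
    module N = MeasurableSpace N
  field
    cong     : ∀ {x y} → x M.≈ y → f x N.≈ f y
    preimage : ∀ {S} → N.Measurable S → M.Measurable (f ⊢ S)

------------------------------------------------------------------------
-- The Borel σ-algebra of the real line

ℝ-Open : Pred (Pred ℝ 0ℓ) (suc 0ℓ)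
ℝ-Open O = ∀ x → x ∈ O →
  ∃₂ λ u v → u <ℝ x × x <ℝ v × (∀ y → u <ℝ y → y <ℝ v → y ∈ O)

ℝ-borel : MeasurableSpace (suc 0ℓ) 0ℓ (suc 0ℓ)
ℝ-borel = generate ℝ-setoid ℝ-Open
  λ {_} open-O {x} {y} (x≤y , y≤x) x∈O →
    let (u , v , (q , q∉u , q∈x) , (r , r∉x , r∈v) , uv⊆O) = open-O x x∈O
    in uv⊆O y (q , q∉u , x≤y q∈x) (r , (λ r∈y → r∉x (y≤x r∈y)) , r∈v)

------------------------------------------------------------------------
-- Standard Borel spaces

module _ (X : Setoid a ℓ) (d : DistanceFunction (Setoid.Carrier X) ℝ) where
  open Setoid X

  Metric-Open : Pred (Pred Carrier 0ℓ) (suc 0ℓ ⊔ a)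
  Metric-Open O = ∀ x → x ∈ O → ∃[ ε ] 0ℝ <ℝ ε × (∀ y → d x y <ℝ ε → y ∈ O)

  Cauchy : Pred (ℕ → Carrier) (suc 0ℓ)
  Cauchy s = ∀ ε → 0ℝ <ℝ ε → ∃[ N ] ∀ i j → N ℕ.≤ i → N ℕ.≤ j → d (s i) (s j) <ℝ ε

  ConvergesTo : (ℕ → Carrier) → Carrier → Set (suc 0ℓ)
  ConvergesTo s x = ∀ ε → 0ℝ <ℝ ε → ∃[ N ] ∀ i → N ℕ.≤ i → d (s i) x <ℝ ε

  record IsPolishMetric : Set (suc 0ℓ ⊔ a ⊔ ℓ) where
    field
      isMetric  : IsGeneralMetric _≈_ _≃_ _≤ℝ_ 0ℝ _+ℝ_ d
      complete  : ∀ s → Cauchy s → ∃[ x ] ConvergesTo s x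
      -- Maybe allows the dense sequence to be partial, so that the empty
      -- space is included.
      separable : Σ[ s ∈ (ℕ → Maybe Carrier) ]
                  ∀ x ε → 0ℝ <ℝ ε → ∃₂ λ n y → s n ≡ just y × d x y <ℝ ε

IsStandardBorel : MeasurableSpace a ℓ m → Set (suc 0ℓ ⊔ a ⊔ ℓ ⊔ m)
IsStandardBorel M = Σ[ d ∈ DistanceFunction Carrier ℝ ]
  IsPolishMetric setoid d ×
  (∀ S → Measurable S ⇔ S ∈ Generated (Metric-Open setoid d))
  where open MeasurableSpace M

------------------------------------------------------------------------
-- Borel G-spaces

CountablyInfinite : Setoid a ℓ → Set (a ⊔ ℓ)
CountablyInfinite S = Bijection (≡ₚ.setoid ℕ) S

record BorelGSpace (G : Group c ℓ) (a ℓ₁ m : Level) :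
                   Set (suc (c ⊔ ℓ ⊔ a ⊔ ℓ₁ ⊔ m)) where
  private module G = Group G

  infixr 7 _·_
  field
    space           : MeasurableSpace a ℓ₁ m
    isStandardBorel : IsStandardBorel space

  open MeasurableSpace space public

  field
    _·_      : G.Carrier → Carrier → Carrier
    identity : ∀ x → G.ε · x ≈ x
    compat   : ∀ g h x → (g G.∙ h) · x ≈ g · (h · x)
    borel    : IsMeasurableMap (discrete G.setoid ⊗ space) space (uncurry _·_)

  orbit : Carrier → Pred Carrier (c ⊔ ℓ₁)
  orbit x y = ∃[ g ] y ≈ g · x

  translate : G.Carrier → Pred Carrier p → Pred Carrier (a ⊔ ℓ₁ ⊔ p)
  translate g P y = ∃[ x ] x ∈ P × y ≈ g · x

FiniteSubset : (S : Setoid a ℓ) → Pred (Setoid.Carrier S) p → Set (a ⊔ ℓ ⊔ p)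
FiniteSubset S P = ∃[ xs ] ∀ y → y ∈ P → y ∈ₗ xs
  where open Membership S renaming (_∈_ to _∈ₗ_)

Aperiodic : {G : Group c ℓ} → BorelGSpace G a ℓ₁ m → Set (c ⊔ a ⊔ ℓ₁)
Aperiodic X = ∀ x → ¬ FiniteSubset setoid (orbit x)
  where open BorelGSpace X

Invariant : {G : Group c ℓ} (X : BorelGSpace G a ℓ₁ m) →
            Rel (BorelGSpace.Carrier X) e → Set (c ⊔ a ⊔ ℓ₁ ⊔ e)
Invariant X E = ∀ {x y} → y ∈ orbit x → E x y
  where open BorelGSpace X

Smooth : (M : MeasurableSpace a ℓ m) → Rel (MeasurableSpace.Carrier M) e →
         Set (suc 0ℓ ⊔ a ⊔ ℓ ⊔ m ⊔ e)
Smooth M E = Σ[ h ∈ (Carrier → ℝ) ]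
  IsMeasurableMap M ℝ-borel h × (∀ x y → E x y ⇔ h x ≃ h y)
  where open MeasurableSpace M

record IsBorelPartition (M : MeasurableSpace a ℓ m) {n : ℕ}
                        (P : Fin n → Pred (MeasurableSpace.Carrier M) 0ℓ) :
                        Set (a ⊔ m) where
  open MeasurableSpace M
  field
    measurable : ∀ i → Measurable (P i)
    cover      : ∀ x → ∃[ i ] x ∈ P i
    disjoint   : ∀ {i j x} → x ∈ P i → x ∈ P j → i ≡ j

Separates : {A : Set a} → Pred A p → A → A → Set p
Separates S x y = (x ∈ S × y ∉ S) ⊎ (x ∉ S × y ∈ S)

{-# OPTIONS --safe #-}
-- Enumerate G and call the sequence of bits (g · x ∈ A), g ∈ G, the A-name of x.
--
-- A single Borel set A can be chosen with infinitely many names on every orbit.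
-- Let U₀, U₁, … be Borel sets separating the points of X.  If some Uₙ has
-- infinitely many names on the orbit, let A be the first such Uₙ there.
-- Otherwise the leftmost of the finitely many Uₙ-names can be selected level by
-- level, giving a decreasing sequence C₀ ⊇ C₁ ⊇ … of classes of the congruences
-- "same U₀-, …, Uₙ₋₁-names"; A is every other nonempty difference Cₙ ∖ Cₙ₊₁.
-- If y and z are first separated at level n, move y into the next nonempty
-- difference after n: this moves z into Cₙ ∖ Cₙ₊₁, of the other colour, so
-- A-names separate the points of the orbit.
--
-- Infinitely many names accumulate along a leftmost branch of 2^ℕ, and the length
-- of agreement with that branch takes infinitely many values on the orbit.  The
-- set B carries the i-th bit of the E-invariant real h at the points with the
-- i-th of these values.  The A-name locates these points, so the names of A and B
-- determine h, and the four Boolean combinations of A and B form the partition.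
module Submission where

open import Defs
open import Algebra.Bundles using (Group)
open import Axiom.ExcludedMiddle using (ExcludedMiddle)
open import Data.Empty using (⊥; ⊥-elim)
open import Data.Fin.Base using (Fin; combine; quotient; remainder) renaming (zero to fzero; suc to fsuc)
open import Data.Fin.Properties using (remQuot-combine; combine-remQuot)
open import Data.Integer.Base using (+_; -[1+_]; _⊖_)
open import Data.List.Base using (List; []; _∷_; _++_)
import Data.List.Membership.Setoid as SetoidMembership
import Data.List.Membership.Setoid.Properties as SetoidMembershipₚ
open import Data.List.Relation.Unary.Any as Any using (here)
open import Data.Maybe.Base using (Maybe; just; nothing)
open import Data.Nat.Base using (ℕ; zero; suc; _+_; _≤_; _<_; z≤n; s≤s; _≤′_; ≤′-refl; ≤′-step)
open import Data.Nat.Properties using (≤-refl; ≤-trans; ≤-total; m≤m+n; m≤n+m; m≤n⇒m≤1+n; ≤⇒≤′; ≰⇒>; <⇒≱; n≮0; n<1+n; m<1+n⇒m<n∨m≡n; <-cmp; +-suc; +-identityʳ; suc-injective; m≤n⇒∃[o]m+o≡n)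
open import Data.Product.Base using (Σ; ∃; ∃₂; _×_; _,_; proj₁; proj₂)
open import Data.Rational.Base as ℚ using (ℚ; 0ℚ; 1ℚ; ½)
import Data.Rational.Properties as ℚₚ
open import Data.Sum.Base using (_⊎_; inj₁; inj₂; [_,_]′)
open import Data.Unit.Base using (⊤; tt)
open import Function.Base using (_∘_; id)
open import Function.Bundles using (_⇔_; mk⇔; Equivalence; Bijection)
open import Function.Metric.Core using (DistanceFunction)
open import Function.Metric.Structures using (IsGeneralMetric)
open import Function.Properties.Equivalence using (⇔-isEquivalence)
open import Level using (Level; 0ℓ; _⊔_) renaming (suc to lsuc)
open import Relation.Binary.Bundles using (Setoid)
open import Relation.Binary.Core using (Rel)
open import Relation.Binary.Definitions using (_Respects_; tri<; tri≈; tri>)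
open import Relation.Binary.Structures using (IsEquivalence)
open import Relation.Binary.PropositionalEquality as ≡ using (_≡_; refl)
open import Relation.Nullary.Decidable.Core using (Dec; yes; no; decidable-stable)
open import Relation.Nullary.Negation.Core using (¬_; contradiction)
open import Relation.Unary using (Pred; _∈_; _∉_; _≐_; ∅; ∁; ⋃; _⊢_)

open Equivalence using (to; from)

-- Set algebras closed under a sequence of maps.

private
  variable
    a ℓ ℓ₁ ℓ₂ m : Level

module ⇔ {ℓ} = IsEquivalence (⇔-isEquivalence {ℓ})

¬-⇔ : {P Q : Set} → P ⇔ Q → (¬ P) ⇔ (¬ Q)
¬-⇔ e = mk⇔ (_∘ from e) (_∘ to e)

-- Two kinds of algebra are meant: the Borel sets, and the sets respecting a relation preserved by
-- the maps. One closure proof then shows both that a construction is Borel and that it is readable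
-- off, say, a name.
record IsInvariantσAlgebra {X : Set a} (act : ℕ → X → X) (𝓜 : Pred (Pred X 0ℓ) m) :
                           Set (a ⊔ m ⊔ lsuc 0ℓ) where
  field
    extensional : ∀ {S T} → S ≐ T → 𝓜 S → 𝓜 T
    ∅-closed    : 𝓜 ∅
    ∁-closed    : ∀ {S} → 𝓜 S → 𝓜 (∁ S)
    ⋃-closed    : ∀ {S : ℕ → Pred X 0ℓ} → (∀ n → 𝓜 (S n)) → 𝓜 (⋃ ℕ S)
    act-closed  : ∀ i {S} → 𝓜 S → 𝓜 (act i ⊢ S)

module Closure (em : ExcludedMiddle 0ℓ) {a m} {X : Set a} {act : ℕ → X → X} {𝓜 : Pred (Pred X 0ℓ) m}
               (σ : IsInvariantσAlgebra act 𝓜) where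
  open IsInvariantσAlgebra σ public
    using (extensional) renaming (∁-closed to ¬-closed; ⋃-closed to ∃-closed; act-closed to ⊢-closed)
  open IsInvariantσAlgebra σ using (∅-closed)

  const-closed : ∀ P → 𝓜 (λ _ → P)
  const-closed P with em {P}
  ... | yes p = extensional ((λ _ → p) , λ _ ()) (¬-closed ∅-closed)
  ... | no ¬p = extensional ((λ ()) , ¬p) ∅-closed

  ∀-closed : ∀ {S : ℕ → Pred X 0ℓ} → (∀ n → 𝓜 (S n)) → 𝓜 (λ x → ∀ n → S n x)
  ∀-closed c = extensional
    ((λ ¬∃ n → decidable-stable em λ ¬s → ¬∃ (n , ¬s)) , λ s (n , ¬s) → ¬s (s n))
    (¬-closed (∃-closed λ n → ¬-closed (c n)))

  ⊎-closed : ∀ {S T} → 𝓜 S → 𝓜 T → 𝓜 (λ x → S x ⊎ T x)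
  ⊎-closed {S} {T} s t = extensional
    ((λ { (zero , p) → inj₁ p ; (suc _ , q) → inj₂ q }) ,
     λ { (inj₁ p) → 0 , p ; (inj₂ q) → 1 , q })
    (∃-closed {S = cases} λ { zero → s ; (suc _) → t })
    where
    cases : ℕ → Pred X 0ℓ
    cases zero    = S
    cases (suc _) = T

  →-closed : ∀ {S T} → 𝓜 S → 𝓜 T → 𝓜 (λ x → S x → T x)
  →-closed {S} {T} s t = extensional
    ((λ { (inj₁ ¬p) p → ⊥-elim (¬p p) ; (inj₂ q) _ → q }) , λ {x} → classical x)
    (⊎-closed (¬-closed s) t)
    where
    classical : ∀ x → (S x → T x) → ¬ S x ⊎ T x
    classical x f with em {S x}
    ... | yes p = inj₂ (f p)
    ... | no ¬p = inj₁ ¬p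

  ×-closed : ∀ {S T} → 𝓜 S → 𝓜 T → 𝓜 (λ x → S x × T x)
  ×-closed s t = extensional
    ((λ f → decidable-stable em (λ ¬p → f (λ p → ⊥-elim (¬p p))) ,
            decidable-stable em (λ ¬q → f (λ _ → ¬q))) ,
     λ (p , q) f → f p q)
    (¬-closed (→-closed s (¬-closed t)))

  ⇔-closed : ∀ {S T} → 𝓜 S → 𝓜 T → 𝓜 (λ x → S x ⇔ T x)
  ⇔-closed s t = extensional
    ((λ (f , g) → mk⇔ f g) , λ e → to e , from e)
    (×-closed (→-closed s t) (→-closed t s))

-- Ranks within a set of natural numbers.

module Counting (em : ExcludedMiddle 0ℓ) where

  private
    bump : {P : Set} → Dec P → ℕ → ℕ
    bump (yes _) = suc
    bump (no  _) = id

  count : (ℕ → Set) → ℕ → ℕ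
  count S zero    = zero
  count S (suc t) = bump (em {S t}) (count S t)

  count-yes : ∀ {S t} → S t → count S (suc t) ≡ suc (count S t)
  count-yes {S} {t} s with em {S t}
  ... | yes _ = refl
  ... | no ¬s = contradiction s ¬s

  count-no : ∀ {S t} → ¬ S t → count S (suc t) ≡ count S t
  count-no {S} {t} ¬s with em {S t}
  ... | yes s = contradiction s ¬s
  ... | no _  = refl

  -- A Boolean form of the recursion, by which conditions `count = i` are seen to stay in a
  -- σ-algebra.
  count-suc-≡ : ∀ S t {i} →
    (count S (suc t) ≡ i) ⇔ ((S t × suc (count S t) ≡ i) ⊎ (¬ S t × count S t ≡ i))
  count-suc-≡ S t with em {S t}
  ... | yes s = mk⇔ (λ e → inj₁ (s , e)) λ { (inj₁ (_ , e)) → e ; (inj₂ (¬s , _)) → contradiction s ¬s }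
  ... | no ¬s = mk⇔ (λ e → inj₂ (¬s , e)) λ { (inj₁ (s , _)) → contradiction s ¬s ; (inj₂ (_ , e)) → e }

  count-cong : ∀ {S T} → (∀ t → S t ⇔ T t) → ∀ t → count S t ≡ count T t
  count-cong S⇔T zero = refl
  count-cong {S} {T} S⇔T (suc t) with em {S t}
  ... | yes s = ≡.trans (≡.cong suc (count-cong S⇔T t)) (≡.sym (count-yes {T} (to (S⇔T t) s)))
  ... | no ¬s = ≡.trans (count-cong S⇔T t) (≡.sym (count-no {T} (¬s ∘ from (S⇔T t))))

  count-mono : ∀ S {i j} → i ≤ j → count S i ≤ count S j
  count-mono S = go ∘ ≤⇒≤′
    where
    go : ∀ {i j} → i ≤′ j → count S i ≤ count S j
    go ≤′-refl = ≤-refl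
    go (≤′-step {j} p) with em {S j}
    ... | yes _ = m≤n⇒m≤1+n (go p)
    ... | no _  = go p

  Unbounded : (ℕ → Set) → Set
  Unbounded S = ∀ n → ∃ λ t → n ≤ t × S t

  -- The search from `n` stops at the first member, so it passes only non-members and the count does
  -- not change.
  first-after : ∀ S n → (∃ λ t → n ≤ t × S t) → ∃ λ t → S t × count S t ≡ count S n
  first-after S n (t , n≤t , s) with m≤n⇒∃[o]m+o≡n n≤t
  ... | d , refl = go n d s
    where
    go : ∀ n d → S (n + d) → ∃ λ t → S t × count S t ≡ count S n
    go n zero s = n , ≡.subst S (+-identityʳ n) s , refl
    go n (suc d) s with em {S n}
    ... | yes s′ = n , s′ , refl
    ... | no ¬s with go (suc n) d (≡.subst S (+-suc n d) s)
    ...   | t , s′ , e = t , s′ , ≡.trans e (count-no {S} ¬s)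

  nth : ∀ S → Unbounded S → ∀ i → ∃ λ t → S t × count S t ≡ i
  nth S unb zero = first-after S 0 (unb 0)
  nth S unb (suc i) with nth S unb i
  ... | t , s , e with first-after S (suc t) (unb (suc t))
  ...   | t′ , s′ , e′ = t′ , s′ , ≡.trans e′ (≡.trans (count-yes {S} s) (≡.cong suc e))

  least : ∀ S → ∃ S → ∃ λ n → S n × (∀ i → i < n → ¬ S i)
  least S (n , s) with first-after S 0 (n , z≤n , s)
  ... | t , s′ , e = t , s′ , λ i i<t s″ →
    -- A member below `t` would make the count at `t` positive, but it equals the count at 0.
    n≮0 (≡.subst₂ _≤_ (count-yes {S} s″) e (count-mono S i<t))

-- Enumerated actions, orbits and names.

record EnumeratedAction (S : Setoid a ℓ) : Set (a ⊔ ℓ) where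
  open Setoid S
  field
    act      : ℕ → Carrier → Carrier
    act-cong : ∀ i {x y} → x ≈ y → act i x ≈ act i y
    comp     : ∀ i j → ∃ λ k → ∀ x → act i (act j x) ≈ act k x
    unit     : ∃ λ i → ∀ x → act i x ≈ x
    inv      : ∀ i → ∃ λ j → ∀ x → act j (act i x) ≈ x

module Dynamics (em : ExcludedMiddle 0ℓ) {a ℓ} (S : Setoid a ℓ) (𝒜 : EnumeratedAction S) where
  open Setoid S renaming (Carrier to X; refl to ≈-refl; sym to ≈-sym; trans to ≈-trans)
  open EnumeratedAction 𝒜
  open SetoidMembership S using () renaming (_∈_ to _∈ₗ_)
  open Counting em

  Resp : Pred (Pred X 0ℓ) (a ⊔ ℓ)
  Resp = _Respects _≈_

  resp-⇔ : ∀ {Q} → Resp Q → ∀ {y z} → y ≈ z → Q y ⇔ Q z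
  resp-⇔ r e = mk⇔ (r e) (r (≈-sym e))


  -- `k` indexes the `j`-th element times the inverse of the `i`-th.
  hop : ∀ i j → ∃ λ k → ∀ x → act k (act i x) ≈ act j x
  hop i j with inv i
  ... | i⁻¹ , li with comp j i⁻¹
  ...   | k , ck = k , λ x → ≈-trans (≈-sym (ck (act i x))) (act-cong j (li x))

  act-injective : ∀ i {x y} → act i x ≈ act i y → x ≈ y
  act-injective i {x} {y} e with inv i
  ... | j , lj = ≈-trans (≈-sym (lj x)) (≈-trans (act-cong j e) (lj y))

  Orbit : Rel X ℓ
  Orbit y z = ∃ λ i → act i y ≈ z

  orbit-sym : ∀ {y z} → Orbit y z → Orbit z y
  orbit-sym {y} (i , e) with inv i
  ... | j , lj = j , ≈-trans (act-cong j (≈-sym e)) (lj y)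

  orbit-trans : ∀ {x y z} → Orbit x y → Orbit y z → Orbit x z
  orbit-trans {x} (i , e) (j , e′) with comp j i
  ... | k , ck = k , ≈-trans (≈-sym (ck x)) (≈-trans (act-cong j e) e′)

  orbit-act : ∀ i x → Orbit x (act i x)
  orbit-act i x = i , ≈-refl

  act-orbit : ∀ i {y z} → Orbit y z → Orbit (act i y) (act i z)
  act-orbit i {y} {z} o = orbit-trans (orbit-sym (orbit-act i y)) (orbit-trans o (orbit-act i z))

  orbit-acts : ∀ x i j → Orbit (act i x) (act j x)
  orbit-acts x i j = orbit-trans (orbit-sym (orbit-act i x)) (orbit-act j x)

  Bits : Set _
  Bits = ℕ → Pred X 0ℓ

  AgreeBelow : Bits → ℕ → Rel X 0ℓ
  AgreeBelow v t y z = ∀ j → j < t → v j y ⇔ v j z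

  Agree : Bits → Rel X 0ℓ
  Agree v y z = ∀ j → v j y ⇔ v j z

  agree-sym : ∀ {v y z} → Agree v y z → Agree v z y
  agree-sym s j = ⇔.sym (s j)

  name : Pred X 0ℓ → Bits
  name V j = act j ⊢ V

  name-resp : ∀ {V} → Resp V → ∀ j → Resp (name V j)
  name-resp r j = r ∘ act-cong j

  -- Translation by the `i`-th element reindexes names, in the same way for all points.
  agree-act : ∀ {V} → Resp V → ∀ i {y z} → Agree (name V) y z → Agree (name V) (act i y) (act i z)
  agree-act r i {y} {z} s j with comp j i
  ... | k , ck = ⇔.trans (resp-⇔ r (ck y)) (⇔.trans (s k) (⇔.sym (resp-⇔ r (ck z))))

  agree-act⁻ : ∀ {V} → Resp V → ∀ i {y z} → Agree (name V) (act i y) (act i z) → Agree (name V) y z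
  agree-act⁻ r i {y} {z} s j with hop i j
  ... | k , hk = ⇔.trans (resp-⇔ r (≈-sym (hk y))) (⇔.trans (s k) (resp-⇔ r (hk z)))

  agree-value : ∀ {V} → Resp V → ∀ {y z} → Agree (name V) y z → V y ⇔ V z
  agree-value r {y} {z} s with unit
  ... | i , ui = ⇔.trans (resp-⇔ r (≈-sym (ui y))) (⇔.trans (s i) (resp-⇔ r (ui z)))

  -- Wide and narrow bits.

  -- By compactness of 2^ℕ, the bits take infinitely many values on the part
  -- of the orbit of x in Q.
  record Wide (v : Bits) (Q : Pred X 0ℓ) (x : X) : Set where
    constructor wide
    field
      apart : ∀ t → ∃ λ i → ∃ λ j → (Q (act i x) × Q (act j x)) ×
              AgreeBelow v t (act i x) (act j x) × ¬ Agree v (act i x) (act j x)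

  open Wide

  module _ {v : Bits} where

    wide-mono : ∀ {Q R x} → (∀ i → Q (act i x) → R (act i x)) → Wide v Q x → Wide v R x
    apart (wide-mono Q⊆R w) t with apart w t
    ... | i , j , (p , q) , rest = i , j , (Q⊆R i p , Q⊆R j q) , rest

    wide-cong : ∀ {v′ Q x} → (∀ i j → v j (act i x) ⇔ v′ j (act i x)) → Wide v Q x → Wide v′ Q x
    apart (wide-cong e w) t with apart w t
    ... | i , j , pq , b , ¬s = i , j , pq
      , (λ k k<t → ⇔.trans (⇔.sym (e i k)) (⇔.trans (b k k<t) (e j k)))
      , λ s → ¬s λ k → ⇔.trans (e i k) (⇔.trans (s k) (⇔.sym (e j k)))

    wide-split : ∀ {Q x} s → Wide v Q x →
      ¬ Wide v (λ z → Q z × ¬ v s z) x → Wide v (λ z → Q z × v s z) x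
    apart (wide-split {Q} {x} s w ¬w) t = result
      where
      t₀ : ∃ λ t₀ → ¬ (∃ λ i → ∃ λ j → ((Q (act i x) × ¬ v s (act i x)) × (Q (act j x) × ¬ v s (act j x))) ×
             AgreeBelow v t₀ (act i x) (act j x) × ¬ Agree v (act i x) (act j x))
      t₀ = decidable-stable em λ ¬∃ → ¬w (wide λ t → decidable-stable em λ ¬p → ¬∃ (t , ¬p))

      -- A pair agreeing below `T` agrees at bit `s`, so it lies in a single half; it also agrees
      -- below `t₀`, so this is not the false half.
      T : ℕ
      T = suc s + (t + proj₁ t₀)

      s<T : s < T
      s<T = s≤s (m≤m+n s _)

      t≤T : t ≤ T
      t≤T = ≤-trans (m≤m+n t _) (m≤n+m _ (suc s))

      t₀≤T : proj₁ t₀ ≤ T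
      t₀≤T = ≤-trans (m≤n+m _ t) (m≤n+m _ (suc s))

      result : ∃ λ i → ∃ λ j → ((Q (act i x) × v s (act i x)) × (Q (act j x) × v s (act j x))) ×
             AgreeBelow v t (act i x) (act j x) × ¬ Agree v (act i x) (act j x)
      result with apart w T
      ... | i , j , (p , q) , b , ¬s with em {v s (act i x)}
      ...   | yes y = i , j , ((p , y) , (q , to (b s s<T) y)) , (λ k k<t → b k (≤-trans k<t t≤T)) , ¬s
      ...   | no ¬y = contradiction
        (i , j , ((p , ¬y) , (q , ¬y ∘ from (b s s<T))) , (λ k k<t → b k (≤-trans k<t t₀≤T)) , ¬s)
        (proj₂ t₀)

    -- Negated wideness is finiteness in usable form: at most 2^t bit sequences occur.
    narrow : ∀ {Q x} → ¬ Wide v Q x → ∃ λ t → ∀ i j → Q (act i x) → Q (act j x) →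
      AgreeBelow v t (act i x) (act j x) → Agree v (act i x) (act j x)
    narrow {Q} {x} ¬w = decidable-stable em λ ¬∃ → ¬w (wide λ t → decidable-stable em λ ¬p →
      ¬∃ (t , λ i j p q b → decidable-stable em λ ¬s → ¬p (i , j , (p , q) , b , ¬s)))

    module _ (v-resp : ∀ j → Resp (v j)) where

      agreeBelow-resp : ∀ {t y y′ z z′} → y ≈ y′ → z ≈ z′ → AgreeBelow v t y z → AgreeBelow v t y′ z′
      agreeBelow-resp e e′ b k k<t =
        ⇔.trans (resp-⇔ (v-resp k) (≈-sym e)) (⇔.trans (b k k<t) (resp-⇔ (v-resp k) e′))

      agree-resp : ∀ {y y′ z z′} → y ≈ y′ → z ≈ z′ → Agree v y z → Agree v y′ z′
      agree-resp e e′ s k =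
        ⇔.trans (resp-⇔ (v-resp k) (≈-sym e)) (⇔.trans (s k) (resp-⇔ (v-resp k) e′))

      wide-orbit : ∀ {Q} → Resp Q → ∀ {y z} → Orbit y z → Wide v Q y → Wide v Q z
      apart (wide-orbit {Q} Q-resp {y} {z} o w) t with apart w t
      ... | i , j , (p , q) , b , ¬s
        with orbit-trans (orbit-sym o) (orbit-act i y) | orbit-trans (orbit-sym o) (orbit-act j y)
      ...   | i′ , e | j′ , e′ = i′ , j′ , (Q-resp (≈-sym e) p , Q-resp (≈-sym e′) q)
              , agreeBelow-resp (≈-sym e) (≈-sym e′) b
              , ¬s ∘ agree-resp e e′

  -- Painting the strata of a decreasing chain.

  OrbitInvariant : Pred (Pred X 0ℓ) (a ⊔ ℓ)
  OrbitInvariant Q = ∀ {y z} → Orbit y z → Q y → Q z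

  occurs-orbit : ∀ {Q} → Resp Q → OrbitInvariant (λ x → ∃ λ i → Q (act i x))
  occurs-orbit r {y} o (i , q) with orbit-trans (orbit-sym o) (orbit-act i y)
  ... | j , e = j , r (≈-sym e) q

  module Painting (N : ℕ → Pred X 0ℓ) (N-suc : ∀ t {z} → N (suc t) z → N t z)
                  (N-resp : ∀ t → Resp (N t)) where

    Stratum : ℕ → Pred X 0ℓ
    Stratum t z = N t z × ¬ N (suc t) z

    Occurs : X → ℕ → Set
    Occurs x t = ∃ λ i → Stratum t (act i x)

    -- Counting from 0, the `i`-th occupied stratum of each orbit receives `b i`. The quantifier
    -- over `i` displays the set as a countable union, for `paint-closed`.
    paint : Bits → Pred X 0ℓ
    paint b z = ∃ λ t → Stratum t z × ∃ λ i → count (Occurs z) t ≡ i × b i z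

    N-anti : ∀ {s t} → s ≤ t → ∀ {z} → N t z → N s z
    N-anti = go ∘ ≤⇒≤′
      where
      go : ∀ {s t} → s ≤′ t → ∀ {z} → N t z → N s z
      go ≤′-refl n = n
      go (≤′-step p) n = go p (N-suc _ n)

    stratum-unique : ∀ {s t z} → Stratum s z → Stratum t z → s ≡ t
    stratum-unique {s} {t} (n , ¬n) (n′ , ¬n′) with <-cmp s t
    ... | tri< s<t _ _ = contradiction (N-anti s<t n′) ¬n
    ... | tri≈ _ e _   = e
    ... | tri> _ _ t<s = contradiction (N-anti t<s n) ¬n′

    stratum-resp : ∀ t → Resp (Stratum t)
    stratum-resp t e (n , ¬n) = N-resp t e n , ¬n ∘ N-resp (suc t) (≈-sym e)

    paint-stratum : ∀ {b t i z} → Stratum t z → count (Occurs z) t ≡ i → paint b z ⇔ b i z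
    paint-stratum {b} {t} {i} {z} l e = mk⇔ fwd (λ y → t , l , i , e , y)
      where
      fwd : paint b z → b i z
      fwd (t′ , l′ , i′ , e′ , y) with stratum-unique l l′
      ... | refl = ≡.subst (λ i → b i z) (≡.trans (≡.sym e′) e) y

    count-orbit : ∀ {y z} → Orbit y z → ∀ t → count (Occurs y) t ≡ count (Occurs z) t
    count-orbit o = count-cong λ t →
      mk⇔ (occurs-orbit (stratum-resp t) o) (occurs-orbit (stratum-resp t) (orbit-sym o))

    -- If no stratum from `t` on contained `z`, induction from `t` would keep `z` in the whole
    -- chain.
    drop : ∀ {t z} → N t z → ¬ (∀ s → N s z) → ∃ λ s → t ≤ s × Stratum s z
    drop {t} {z} n ¬all = decidable-stable em λ ¬∃ → ¬all (all ¬∃)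
      where
      above : ¬ (∃ λ s → t ≤ s × Stratum s z) → ∀ d → N (t + d) z
      above ¬∃ zero = ≡.subst (λ s → N s z) (≡.sym (+-identityʳ t)) n
      above ¬∃ (suc d) = ≡.subst (λ s → N s z) (≡.sym (+-suc t d))
        (decidable-stable em λ ¬n → ¬∃ (t + d , m≤m+n t d , above ¬∃ d , ¬n))

      all : ¬ (∃ λ s → t ≤ s × Stratum s z) → ∀ s → N s z
      all ¬∃ s = N-anti (m≤n+m s t) (above ¬∃ s)

    module _ {m} {𝓜 : Pred (Pred X 0ℓ) m} (σ : IsInvariantσAlgebra act 𝓜)
             (N-closed : ∀ t → 𝓜 (N t)) where
      open Closure em σ

      stratum-closed : ∀ t → 𝓜 (Stratum t)
      stratum-closed t = ×-closed (N-closed t) (¬-closed (N-closed (suc t)))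

      occurs-closed : ∀ t → 𝓜 (λ z → Occurs z t)
      occurs-closed t = ∃-closed λ i → ⊢-closed i (stratum-closed t)

      count-closed : ∀ t i → 𝓜 (λ z → count (Occurs z) t ≡ i)
      count-closed zero i = const-closed (0 ≡ i)
      count-closed (suc t) i = extensional
        ((λ {z} → from (count-suc-≡ (Occurs z) t)) , λ {z} → to (count-suc-≡ (Occurs z) t))
        (⊎-closed (×-closed (occurs-closed t) (count-suc-closed i))
                  (×-closed (¬-closed (occurs-closed t)) (count-closed t i)))
        where
        count-suc-closed : ∀ i → 𝓜 (λ z → suc (count (Occurs z) t) ≡ i)
        count-suc-closed zero    = extensional ((λ ()) , λ ()) (const-closed ⊥)
        count-suc-closed (suc i) = extensional (≡.cong suc , suc-injective) (count-closed t i)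

      paint-closed : ∀ {b} → (∀ i → 𝓜 (b i)) → 𝓜 (paint b)
      paint-closed c = ∃-closed λ t → ×-closed (stratum-closed t)
        (∃-closed λ i → ×-closed (count-closed t i) (c i))

  -- Wideness in invariant σ-algebras.

  module _ {m} {𝓜 : Pred (Pred X 0ℓ) m} (σ : IsInvariantσAlgebra act 𝓜) where
    open Closure em σ

    -- As orbits are enumerated by `act`, every quantifier in wideness runs over ℕ.
    wide-closed : ∀ {v Q} → (∀ j → 𝓜 (v j)) → 𝓜 Q → 𝓜 (Wide v Q)
    wide-closed vc qc = extensional (wide , apart) (∀-closed λ t → ∃-closed λ i → ∃-closed λ j →
      ×-closed (×-closed (⊢-closed i qc) (⊢-closed j qc))
        (×-closed
          (∀-closed λ k → →-closed (const-closed (k < t)) (⇔-closed (⊢-closed i (vc k)) (⊢-closed j (vc k))))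
          (¬-closed (∀-closed λ k → ⇔-closed (⊢-closed i (vc k)) (⊢-closed j (vc k))))))

  -- For `R` name agreement, belonging to this algebra means being readable off the name, which
  -- allows points of different orbits to be compared.
  respects-algebra : ∀ {r} (R : Rel X r) → (∀ {y z} → R y z → R z y) →
                     (∀ i {y z} → R y z → R (act i y) (act i z)) → IsInvariantσAlgebra act (_Respects R)
  respects-algebra R R-sym R-act = record
    { extensional = λ (S⊆T , T⊆S) resp e t → S⊆T (resp e (T⊆S t))
    ; ∅-closed    = λ _ ()
    ; ∁-closed    = λ resp e ¬s s → ¬s (resp (R-sym e) s)
    ; ⋃-closed    = λ resp e (n , s) → n , resp n e s
    ; act-closed  = λ i resp e → resp (R-act i e)
    }

  ≈-algebra : IsInvariantσAlgebra act Resp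
  ≈-algebra = respects-algebra _≈_ ≈-sym act-cong

  -- Markers along the leftmost branch.

  -- On an orbit on which the names of V are wide, Near t cuts out the names
  -- agreeing up to t with the leftmost branch of 2^ℕ along which they accumulate.
  module Markers {V : Pred X 0ℓ} (V-resp : Resp V) where

    -- The branch turns to false whenever the false half is still wide, and to true otherwise.
    Near : ℕ → Pred X 0ℓ
    Near zero    z = ⊤
    Near (suc t) z = Near t z × (name V t z ⇔ (¬ Wide (name V) (λ w → Near t w × ¬ name V t w) z))

    near-closed : ∀ {m} {𝓜 : Pred (Pred X 0ℓ) m} → IsInvariantσAlgebra act 𝓜 → 𝓜 V → ∀ t → 𝓜 (Near t)
    near-closed {𝓜 = 𝓜} σ V∈𝓜 = go
      where
      open Closure em σ
      go : ∀ t → 𝓜 (Near t)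
      go zero    = const-closed ⊤
      go (suc t) = ×-closed (go t) (⇔-closed (⊢-closed t V∈𝓜)
        (¬-closed (wide-closed σ (λ j → ⊢-closed j V∈𝓜) (×-closed (go t) (¬-closed (⊢-closed t V∈𝓜))))))

    near-resp : ∀ t → Resp (Near t)
    near-resp = near-closed ≈-algebra V-resp

    open Painting Near (λ _ → proj₁) near-resp public

    turn-orbit : ∀ t → OrbitInvariant (Wide (name V) (λ w → Near t w × ¬ name V t w))
    turn-orbit t = wide-orbit (name-resp V-resp)
      (λ e (n , ¬v) → near-resp t e n , ¬v ∘ name-resp V-resp t (≈-sym e))

    -- Each turn keeps a wide half: the false one if it is wide, else the true one by `wide-split`.
    near-wide : ∀ {x} → Wide (name V) (λ _ → ⊤) x → ∀ t → Wide (name V) (Near t) x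
    near-wide w zero = w
    near-wide {x} w (suc t) with em {Wide (name V) (λ w → Near t w × ¬ name V t w) x}
    ... | yes w₀ = wide-mono
      (λ i (n , ¬v) → n , mk⇔ (λ v → contradiction v ¬v)
                              (λ ¬w₀ → contradiction (turn-orbit t (orbit-act i x) w₀) ¬w₀)) w₀
    ... | no ¬w₀ = wide-mono
      (λ i (n , v) → n , mk⇔ (λ _ → ¬w₀ ∘ turn-orbit t (orbit-sym (orbit-act i x))) (λ _ → v))
      (wide-split t (near-wide w t) ¬w₀)

    near-agree : ∀ t {y z} → Orbit y z → Near t y → Near t z → AgreeBelow (name V) t y z
    near-agree (suc t) o (n , e) (n′ , e′) j j<1+t with m<1+n⇒m<n∨m≡n j<1+t
    ... | inj₁ j<t  = near-agree t o n n′ j j<t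
    ... | inj₂ refl = ⇔.trans e (⇔.trans
      (¬-⇔ (mk⇔ (turn-orbit t o) (turn-orbit t (orbit-sym o)))) (⇔.sym e′))

    -- Wideness puts two different names in `Near n`. Only one name can stay near forever, so one of
    -- the two points drops off, at stratum `n` or later.
    occurs-unbounded : ∀ {x} → Wide (name V) (λ _ → ⊤) x → Unbounded (Occurs x)
    occurs-unbounded {x} w n with apart (near-wide w n) 0
    ... | i , j , (p , q) , _ , ¬s
      with em {∀ s → Near s (act i x)} | em {∀ s → Near s (act j x)}
    ...   | no ¬all | _ = let s , n≤s , l = drop p ¬all in s , n≤s , i , l
    ...   | yes _ | no ¬all = let s , n≤s , l = drop q ¬all in s , n≤s , j , l
    ...   | yes all-i | yes all-j = contradiction
      (λ k → near-agree (suc k) (orbit-acts x i j) (all-i (suc k)) (all-j (suc k)) k ≤-refl) ¬s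

    name-algebra : IsInvariantσAlgebra act (_Respects (Agree (name V)))
    name-algebra = respects-algebra (Agree (name V)) (agree-sym {name V}) (agree-act V-resp)

    private
      near-det : ∀ t {y z} → Agree (name V) y z → Near t y → Near t z
      near-det = near-closed name-algebra λ s → to (agree-value V-resp s)

    -- Some translate of `x` lies in the `i`-th occupied stratum. Its stratum and rank are functions
    -- of its `V`-name, so the same translate of `y`, in whatever orbit, shares them, and there
    -- `paint b` shows `b i`.
    paint-decodes : ∀ {b x y} → (∀ i → OrbitInvariant (b i)) → Wide (name V) (λ _ → ⊤) x →
      Agree (name V) x y → Agree (name (paint b)) x y → ∀ i → b i x ⇔ b i y
    paint-decodes {b} {x} {y} b-inv w sV sB i with nth (Occurs x) (occurs-unbounded w) i
    ... | t , (k , l) , c =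
      ⇔.trans (bx x) (⇔.trans (⇔.sym (paint-stratum {b} l cx))
        (⇔.trans (sB k) (⇔.trans (paint-stratum {b} l′ cy) (⇔.sym (bx y)))))
      where
      sk : Agree (name V) (act k x) (act k y)
      sk = agree-act V-resp k sV

      bx : ∀ z → b i z ⇔ b i (act k z)
      bx z = mk⇔ (b-inv i (orbit-act k z)) (b-inv i (orbit-sym (orbit-act k z)))

      cx : count (Occurs (act k x)) t ≡ i
      cx = ≡.trans (≡.sym (count-orbit (orbit-act k x) t)) c

      l′ : Stratum t (act k y)
      l′ = stratum-closed name-algebra near-det t sk l

      cy : count (Occurs (act k y)) t ≡ i
      cy = count-closed name-algebra near-det t i sk cx

  -- Lexicographically leftmost points.

  -- The points of Q whose first j bits are lexicographically least among those
  -- occurring in Q on the orbit, a false bit preceding a true one.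
  Leftmost : Bits → Pred X 0ℓ → ℕ → Pred X 0ℓ
  Leftmost v Q zero    z = Q z
  Leftmost v Q (suc j) z = Leftmost v Q j z × (v j z → ∀ i → Leftmost v Q j (act i z) → v j (act i z))

  leftmost-closed : ∀ {m} {𝓜 : Pred (Pred X 0ℓ) m} → IsInvariantσAlgebra act 𝓜 →
    ∀ {v Q} → (∀ j → 𝓜 (v j)) → 𝓜 Q → ∀ j → 𝓜 (Leftmost v Q j)
  leftmost-closed {𝓜 = 𝓜} σ {v} {Q} vc qc = go
    where
    open Closure em σ
    go : ∀ j → 𝓜 (Leftmost v Q j)
    go zero    = qc
    go (suc j) = ×-closed (go j) (→-closed (vc j) (∀-closed λ i →
      →-closed (⊢-closed i (go j)) (⊢-closed i (vc j))))

  module _ {v : Bits} {Q : Pred X 0ℓ} (v-resp : ∀ j → Resp (v j)) (Q-resp : Resp Q) where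

    leftmost-resp : ∀ j → Resp (Leftmost v Q j)
    leftmost-resp = leftmost-closed ≈-algebra v-resp Q-resp

    leftmost-bit : ∀ j {y z} → Orbit y z → Leftmost v Q (suc j) y → Leftmost v Q j z → v j y → v j z
    leftmost-bit j (i , e) (_ , l) n u = v-resp j e (l u i (leftmost-resp j (≈-sym e) n))

    leftmost-agreeBelow : ∀ t {y z} → Orbit y z → Leftmost v Q t y → Leftmost v Q t z → AgreeBelow v t y z
    leftmost-agreeBelow (suc t) o l l′ j j<1+t with m<1+n⇒m<n∨m≡n j<1+t
    ... | inj₁ j<t  = leftmost-agreeBelow t o (proj₁ l) (proj₁ l′) j j<t
    ... | inj₂ refl = mk⇔ (leftmost-bit t o l (proj₁ l′)) (leftmost-bit t (orbit-sym o) l′ (proj₁ l))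

    leftmost-agree : ∀ {y z} → Orbit y z → (∀ j → Leftmost v Q j y) → (∀ j → Leftmost v Q j z) → Agree v y z
    leftmost-agree o l l′ j = leftmost-agreeBelow (suc j) o (l (suc j)) (l′ (suc j)) j ≤-refl

    -- Once membership in `Q` is granted, being leftmost depends only on the bits and the orbit.
    leftmost-transfer : ∀ {y z} → Orbit y z → Agree v y z → (Q y → Q z) → ∀ j → Leftmost v Q j y → Leftmost v Q j z
    leftmost-transfer o s f zero q = f q
    leftmost-transfer {y} {z} o s f (suc j) l@(n , _) = leftmost-transfer o s f j n , λ u i →
      λ n′ → leftmost-bit j (orbit-trans o (orbit-act i z)) l n′ (from (s j) u)

    leftmost-nonempty : ∀ {x} → (∃ λ i → Q (act i x)) → ∀ j → ∃ λ i → Leftmost v Q j (act i x)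
    leftmost-nonempty q zero = q
    -- A leftmost point with bit false stays leftmost vacuously; if there is none, all share the bit
    -- true and any of them stays.
    leftmost-nonempty {x} q (suc j) with em {∃ λ i → Leftmost v Q j (act i x) × ¬ v j (act i x)}
    ... | yes (i , l , ¬u) = i , l , λ u → contradiction u ¬u
    ... | no ¬∃ with leftmost-nonempty q j
    ...   | i , l = i , l , λ _ k n → decidable-stable em λ ¬u →
            let o = orbit-trans (orbit-act i x) (orbit-act k (act i x))
            in ¬∃ (proj₁ o , leftmost-resp j (≈-sym (proj₂ o)) n , ¬u ∘ v-resp j (proj₂ o))

    -- By narrowness the first `t` bits decide all others, so a point leftmost for `t` bits ties
    -- with its rivals at every later bit and remains leftmost.
    leftmost-limit : ∀ {x} → ¬ Wide v (λ _ → ⊤) x → (∃ λ i → Q (act i x)) →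
                     ∃ λ i → ∀ j → Leftmost v Q j (act i x)
    leftmost-limit {x} ¬w q with narrow ¬w
    ... | t , nar with leftmost-nonempty q t
    ...   | i , l = i , λ j → [ (λ j≤t → shrink (≤⇒≤′ j≤t) l) , (λ t≤j → grow (≤⇒≤′ t≤j)) ]′ (≤-total j t)
      where
      shrink : ∀ {s t z} → s ≤′ t → Leftmost v Q t z → Leftmost v Q s z
      shrink ≤′-refl     l = l
      shrink (≤′-step p) l = shrink p (proj₁ l)

      grow : ∀ {j} → t ≤′ j → Leftmost v Q j (act i x)
      grow ≤′-refl = l
      grow (≤′-step {j} p) = grow p , λ u k n →
        let (k′ , e) = orbit-trans (orbit-act i x) (orbit-act k (act i x))
            n′ = shrink p (leftmost-resp j (≈-sym e) n)
        in v-resp j e (to (nar i k′ tt tt (leftmost-agreeBelow t (orbit-acts x i k′) l n′) j) u)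

  -- Finite pieces of orbits.

  record Covered (x : X) (Q : Pred X 0ℓ) : Set (a ⊔ ℓ) where
    constructor covered-by
    field
      points : List X
      covers : ∀ i → Q (act i x) → act i x ∈ₗ points

  open Covered

  covered-mono : ∀ {x Q R} → (∀ i → Q (act i x) → R (act i x)) → Covered x R → Covered x Q
  covered-mono Q⊆R (covered-by xs c) = covered-by xs λ i → c i ∘ Q⊆R i

  -- The first `t` bits cut `Q` into at most 2^t cells, and finitely many finite cells have a finite
  -- union. The induction splits on the last bit.
  covered-bits : ∀ v t {Q x} →
    (∀ k → Q (act k x) → Covered x (λ w → Q w × AgreeBelow v t (act k x) w)) → Covered x Q
  covered-bits v zero {Q} {x} f with em {∃ λ k → Q (act k x)}
  ... | yes (k , q) = covered-mono (λ _ q′ → q′ , λ _ ()) (f k q)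
  ... | no ¬∃ = covered-by [] λ i q → contradiction (i , q) ¬∃
  covered-bits v (suc t) {Q} {x} f = covered-by (points on ++ points off) cover
    where
    extend : ∀ {y z} → v t y ⇔ v t z → AgreeBelow v t y z → AgreeBelow v (suc t) y z
    extend e b j j<1+t with m<1+n⇒m<n∨m≡n j<1+t
    ... | inj₁ j<t  = b j j<t
    ... | inj₂ refl = e

    on : Covered x (λ w → Q w × v t w)
    on = covered-bits v t λ k (q , u) →
      covered-mono (λ i ((q′ , u′) , b) → q′ , extend (mk⇔ (λ _ → u′) (λ _ → u)) b) (f k q)

    off : Covered x (λ w → Q w × ¬ v t w)
    off = covered-bits v t λ k (q , ¬u) →
      covered-mono (λ i ((q′ , ¬u′) , b) → q′ , extend (mk⇔ (⊥-elim ∘ ¬u) (⊥-elim ∘ ¬u′)) b) (f k q)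

    cover : ∀ i → Q (act i x) → act i x ∈ₗ points on ++ points off
    cover i q with em {v t (act i x)}
    ... | yes u = SetoidMembershipₚ.∈-++⁺ˡ S (covers on i (q , u))
    ... | no ¬u = SetoidMembershipₚ.∈-++⁺ʳ S (points on) (covers off i (q , ¬u))

  -- Choosing a set with wide names on every orbit.

  Alternating : Bits
  Alternating zero    _ = ⊥
  Alternating (suc i) z = ¬ Alternating i z

  module Selection (U : Bits) (U-resp : ∀ n → Resp (U n)) (U-separates : ∀ {y z} → Agree U y z → y ≈ z)
                   (infinite : ∀ x → ¬ Covered x (λ _ → ⊤)) where

    bits : ℕ → Bits
    bits n = name (U n)

    bits-resp : ∀ n j → Resp (bits n j)
    bits-resp n = name-resp (U-resp n)

    Class : ℕ → Pred X 0ℓ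
    Class zero    z = ⊤
    Class (suc n) z = ∀ j → Leftmost (bits n) (Class n) j z

    WideAt : ℕ → Pred X 0ℓ
    WideAt n = Wide (bits n) (λ _ → ⊤)

    AgreeUpTo : ℕ → Rel X 0ℓ
    AgreeUpTo n y z = ∀ i → i < n → Agree (bits i) y z

    class-closed : ∀ {m} {𝓜 : Pred (Pred X 0ℓ) m} → IsInvariantσAlgebra act 𝓜 →
      (∀ n → 𝓜 (U n)) → ∀ n → 𝓜 (Class n)
    class-closed {𝓜 = 𝓜} σ Uc = go
      where
      open Closure em σ
      go : ∀ n → 𝓜 (Class n)
      go zero    = const-closed ⊤
      go (suc n) = ∀-closed (leftmost-closed σ (λ j → ⊢-closed j (Uc n)) (go n))

    class-resp : ∀ n → Resp (Class n)
    class-resp = class-closed ≈-algebra U-resp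

    open Painting Class (λ _ c → c 0) class-resp public

    -- `Class n` refers only to names at levels below `n`. With `class-agree` this makes it, on each
    -- orbit, empty or one class of `AgreeUpTo n`.
    class-transfer : ∀ n {y z} → Orbit y z → AgreeUpTo n y z → Class n y → Class n z
    class-transfer zero o s c = tt
    class-transfer (suc n) o s c j = leftmost-transfer (bits-resp n) (class-resp n) o (s n ≤-refl)
      (class-transfer n o λ i i<n → s i (m≤n⇒m≤1+n i<n)) j (c j)

    class-agree : ∀ n {y z} → Orbit y z → Class (suc n) y → Class (suc n) z → Agree (bits n) y z
    class-agree n = leftmost-agree (bits-resp n) (class-resp n)

    -- Its names are wide on the orbits on which no U n has wide names.
    Stripes : Pred X 0ℓ
    Stripes = paint Alternating

    alternating-closed : ∀ {m} {𝓜 : Pred (Pred X 0ℓ) m} → IsInvariantσAlgebra act 𝓜 →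
      ∀ i → 𝓜 (Alternating i)
    alternating-closed σ zero    = const-closed ⊥
      where open Closure em σ
    alternating-closed σ (suc i) = ¬-closed (alternating-closed σ i)
      where open Closure em σ

    stripes-closed : ∀ {m} {𝓜 : Pred (Pred X 0ℓ) m} → IsInvariantσAlgebra act 𝓜 →
      (∀ n → 𝓜 (U n)) → 𝓜 Stripes
    stripes-closed σ Uc = paint-closed σ (class-closed σ Uc) (alternating-closed σ)

    -- The colour is the parity of `i`, odd ranks being in the set; the point is an argument to fit
    -- `paint`.
    alternating-value : ∀ i {y z} → Alternating i y ⇔ Alternating i z
    alternating-value zero    = mk⇔ id id
    alternating-value (suc i) {y} {z} = ¬-⇔ (alternating-value i {y} {z})

    module Narrow {x : X} (¬wide : ∀ n → ¬ WideAt n x) where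

      class-nonempty : ∀ n → ∃ λ i → Class n (act i x)
      class-nonempty zero    = 0 , tt
      class-nonempty (suc n) = leftmost-limit (bits-resp n) (class-resp n) (¬wide n) (class-nonempty n)

      class-reach : ∀ n {y} → Orbit x y → ∃ λ i → Class n (act i y)
      class-reach n o = occurs-orbit (class-resp n) o (class-nonempty n)

      -- Without drops from level `n` on, `Class n` would be a single point of the orbit, and by
      -- translation so would every class of `AgreeUpTo n`. As each level has finitely many names,
      -- the orbit would be finite.
      drops-unbounded : Unbounded (Occurs x)
      drops-unbounded n = decidable-stable em λ ¬∃ →
        -- Agreement up to level 0 is vacuous, so the class of `act 0 x` is the whole orbit.
        infinite x (covered-mono (λ _ _ _ ()) (covered ¬∃ n 0 (+-identityʳ n) 0))
        where
        module _ (¬∃ : ¬ (∃ λ t → n ≤ t × Occurs x t)) where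

          all-classes : ∀ {y} → Orbit x y → Class n y → ∀ t → Class t y
          all-classes (i , e) c = decidable-stable em λ ¬all →
            let (t , n≤t , s) = drop c ¬all in ¬∃ (t , n≤t , i , stratum-resp t (≈-sym e) s)

          -- Some `k` carries `y` into `Class n`, and `z` follows. Both translates then lie in all
          -- classes, so no `U t` separates them.
          singleton : ∀ {y z} → Orbit x y → Orbit x z → AgreeUpTo n y z → y ≈ z
          singleton {y} {z} oy oz s =
            let o        = orbit-trans (orbit-sym oy) oz
                (k , c)  = class-reach n oy
                c′       = class-transfer n (act-orbit k o) (λ i i<n → agree-act (U-resp i) k (s i i<n)) c
                all-y    = all-classes (orbit-trans oy (orbit-act k y)) c
                all-z    = all-classes (orbit-trans oz (orbit-act k z)) c′
            in act-injective k (U-separates λ t →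
                 agree-value (U-resp t) (class-agree t (act-orbit k o) (all-y (suc t)) (all-z (suc t))))

          -- Induction on `d`, the distance from level `i` up to `n`: narrow names at level `i`
          -- split a class into finitely many classes of the next level.
          covered : ∀ d i → d + i ≡ n → ∀ k → Covered x (AgreeUpTo i (act k x))
          covered zero i refl k = covered-by (act k x ∷ []) λ j s →
            here (≈-sym (singleton (orbit-act k x) (orbit-act j x) s))
          covered (suc d) i e k with narrow (¬wide i)
          ... | t , nar = covered-bits (bits i) t λ k′ q → covered-mono (λ j → refine q)
                            (covered d (suc i) (≡.trans (+-suc d i) e) k′)
            where
            refine : ∀ {k′ j} → AgreeUpTo i (act k x) (act k′ x) →
              AgreeUpTo i (act k x) (act j x) × AgreeBelow (bits i) t (act k′ x) (act j x) →
              AgreeUpTo (suc i) (act k′ x) (act j x)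
            refine {k′} {j} q (q′ , b) i′ i′<1+i with m<1+n⇒m<n∨m≡n i′<1+i
            ... | inj₁ i′<i = λ l → ⇔.trans (⇔.sym (q i′ i′<i l)) (q′ i′ i′<i l)
            ... | inj₂ refl = nar k′ j tt tt b

      -- If n is the first level separating y from z, some translate moves y
      -- into the next occurring stratum after n, and then z into stratum n.
      stripes-agree : ∀ {y z} → Orbit x y → Orbit x z → Agree (name Stripes) y z → ∀ n → AgreeUpTo n y z
      stripes-agree {y} {z} oy oz sV (suc n) i i<1+n with m<1+n⇒m<n∨m≡n i<1+n
      ... | inj₁ i<n  = stripes-agree oy oz sV n i i<n
      ... | inj₂ refl = decidable-stable em absurd
        where
        o = orbit-trans (orbit-sym oy) oz
        s = stripes-agree oy oz sV n

        follow : ∀ k → Class n (act k y) → Class n (act k z)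
        follow k = class-transfer n (act-orbit k o) λ i i<n → agree-act (U-resp i) k (s i i<n)

        -- The rank of stratum `n`, hence the index of its colour once a point lands there.
        c = count (Occurs x) n

        module _ (¬s : ¬ Agree (bits n) y z) where

          split : ∀ k → Class (suc n) (act k y) → ¬ Class (suc n) (act k z)
          split k cy cz = ¬s (agree-act⁻ (U-resp n) k (class-agree n (act-orbit k o) cy cz))

          contradictory : ∀ t k → count (Occurs x) t ≡ suc c → Stratum t (act k y) → ⊥
          contradictory t k ct sy = paradox (⇔.trans (⇔.sym black) (⇔.trans (sV k) white))
            where
            n<t : n < t
            n<t = ≰⇒> λ t≤n → <⇒≱ (n<1+n c) (≡.subst (_≤ c) ct (count-mono (Occurs x) t≤n))

            cy : Class (suc n) (act k y)
            cy = N-anti n<t (proj₁ sy)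

            black : Stripes (act k y) ⇔ (¬ Alternating c (act k y))
            black = paint-stratum {Alternating} sy
              (≡.trans (≡.sym (count-orbit (orbit-trans oy (orbit-act k y)) t)) ct)

            white : Stripes (act k z) ⇔ Alternating c (act k y)
            white = ⇔.trans (paint-stratum {Alternating} (follow k (cy 0) , split k cy)
              (≡.sym (count-orbit (orbit-trans oz (orbit-act k z)) n))) (alternating-value c {act k z} {act k y})

            paradox : {P : Set} → ¬ ((¬ P) ⇔ P)
            paradox e = ¬p (to e ¬p)
              where ¬p = λ p → from e p p

          absurd : ⊥
          absurd =
            -- Rank `suc c` comes right after that of stratum `n`, so its colour is the opposite
            -- one.
            let (t , s , ct) = nth (Occurs x) drops-unbounded (suc c)
                (k , sy)     = occurs-orbit (stratum-resp t) oy s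
            in contradictory t k ct sy

      -- Otherwise finitely many bits of the name would determine the point, by `stripes-agree` and
      -- separation, and the orbit would be finite.
      stripes-wide : Wide (name Stripes) (λ _ → ⊤) x
      stripes-wide = decidable-stable em λ ¬w → let (t , nar) = narrow ¬w in
        infinite x (covered-bits (name Stripes) t λ k _ → covered-by (act k x ∷ []) λ i (_ , b) →
          here (≈-sym (U-separates λ n → agree-value (U-resp n)
            (stripes-agree (orbit-act k x) (orbit-act i x) (nar k i tt tt b) (suc n) n ≤-refl))))

    wideAt-orbit : ∀ n → OrbitInvariant (WideAt n)
    wideAt-orbit n = wide-orbit (bits-resp n) (λ _ _ → tt)

    FirstWide : ℕ → Pred X 0ℓ
    FirstWide n z = WideAt n z × (∀ i → i < n → ¬ WideAt i z)

    Base : Pred X 0ℓ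
    Base z = (∃ λ n → FirstWide n z × U n z) ⊎ ((∀ n → ¬ WideAt n z) × Stripes z)

    base-closed : ∀ {m} {𝓜 : Pred (Pred X 0ℓ) m} → IsInvariantσAlgebra act 𝓜 → (∀ n → 𝓜 (U n)) → 𝓜 Base
    base-closed {𝓜 = 𝓜} σ Uc = ⊎-closed
      (∃-closed λ n → ×-closed (×-closed (wideAt-closed n) (∀-closed λ i →
        →-closed (const-closed (i < n)) (¬-closed (wideAt-closed i)))) (Uc n))
      (×-closed (∀-closed λ n → ¬-closed (wideAt-closed n)) (stripes-closed σ Uc))
      where
      open Closure em σ
      wideAt-closed : ∀ n → 𝓜 (WideAt n)
      wideAt-closed n = wide-closed σ (λ j → ⊢-closed j (Uc n)) (const-closed ⊤)

    -- The orbit decides which clause of `Base` applies, so on each orbit `Base` coincides with one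
    -- set known to have wide names there.
    base-wide : ∀ x → Wide (name Base) (λ _ → ⊤) x
    base-wide x with em {∃ λ n → WideAt n x}
    ... | no ¬∃ = wide-cong {v = name Stripes}
      (λ i j → mk⇔ (λ s → inj₂ (none i j , s)) (on-stripes i j)) (Narrow.stripes-wide ¬wide)
      where
      ¬wide : ∀ n → ¬ WideAt n x
      ¬wide n w = ¬∃ (n , w)

      none : ∀ i j n → ¬ WideAt n (act j (act i x))
      none i j n w = ¬wide n (wideAt-orbit n (orbit-sym (orbit-trans (orbit-act i x) (orbit-act j (act i x)))) w)

      on-stripes : ∀ i j → Base (act j (act i x)) → Stripes (act j (act i x))
      on-stripes i j (inj₁ (n , (w , _) , _)) = contradiction w (none i j n)
      on-stripes i j (inj₂ (_ , s)) = s
    ... | yes ∃w with least (λ n → WideAt n x) ∃w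
    ...   | n , w , min = wide-cong {v = bits n}
      (λ i j → on-U (orbit-trans (orbit-act i x) (orbit-act j (act i x)))) w
      where
      on-U : ∀ {y} → Orbit x y → U n y ⇔ Base y
      on-U {y} o = mk⇔
        (λ u → inj₁ (n , (wideAt-orbit n o w , λ i i<n w′ → min i i<n (wideAt-orbit i (orbit-sym o) w′)) , u))
        back
        where
        back : Base y → U n y
        back (inj₂ (none , _)) = contradiction (wideAt-orbit n o w) (none n)
        back (inj₁ (n′ , (w′ , min′) , u)) with <-cmp n n′
        ... | tri< n<n′ _ _ = contradiction (wideAt-orbit n o w) (min′ n n<n′)
        ... | tri≈ _ refl _ = u
        ... | tri> _ _ n′<n = contradiction (wideAt-orbit n′ (orbit-sym o) w′) (min n′ n′<n)

  -- Encoding invariant bits by two sets.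

  module _ {m} {𝓜 : Pred (Pred X 0ℓ) m} (σ : IsInvariantσAlgebra act 𝓜)
           {b : Bits} (b-closed : ∀ i → 𝓜 (b i)) (b-invariant : ∀ i → OrbitInvariant (b i)) where

    Encoding : Pred X 0ℓ → Pred X 0ℓ → Set (a ⊔ m)
    Encoding A B = 𝓜 A × 𝓜 B × (∀ {x y} → Agree (name A) x y → Agree (name B) x y → ∀ i → b i x ⇔ b i y)

    encode-over : ∀ A → 𝓜 A → Resp A → (∀ x → Wide (name A) (λ _ → ⊤) x) → ∃ λ B → Encoding A B
    encode-over A A-closed A-resp A-wide =
      paint b , A-closed , paint-closed σ (near-closed σ A-closed) b-closed ,
      λ {x} → paint-decodes b-invariant (A-wide x)
      where open Markers {A} A-resp

    encode : ∀ U → (∀ n → 𝓜 (U n)) → (∀ n → Resp (U n)) → (∀ {y z} → Agree U y z → y ≈ z) →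
             (∀ x → ¬ Covered x (λ _ → ⊤)) → ∃₂ Encoding
    encode U U-closed U-resp U-separates infinite =
      Base , encode-over Base (base-closed σ U-closed) (base-closed ≈-algebra U-resp) base-wide
      where open Selection U U-resp U-separates infinite using (Base; base-closed; base-wide)

-- An enumeration of the rationals.

unpair : ℕ → ℕ × ℕ
unpair zero = 0 , 0
unpair (suc n) with unpair n
... | i , zero  = 0 , suc i
... | i , suc j = suc i , j

unpair-surjective : ∀ i j → ∃ λ n → unpair n ≡ (i , j)
unpair-surjective i j = reach (i + j) i j refl
  where
  reach : ∀ s i j → i + j ≡ s → ∃ λ n → unpair n ≡ (i , j)
  reach _ zero zero _ = 0 , refl
  -- The walk follows antidiagonals, entering each at `(0, j + 1)` from the end `(j, 0)` of the
  -- previous one.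
  reach (suc s) zero (suc j) e with reach s j 0 (≡.trans (+-identityʳ j) (suc-injective e))
  ... | n , eq = suc n , next eq
    where
    next : unpair n ≡ (j , 0) → unpair (suc n) ≡ (0 , suc j)
    next eq rewrite eq = refl
  reach s (suc i) j e with reach s i (suc j) (≡.trans (+-suc i j) e)
  ... | n , eq = suc n , next eq
    where
    next : unpair n ≡ (i , suc j) → unpair (suc n) ≡ (suc i , j)
    next eq rewrite eq = refl

fraction : ℕ × ℕ → ℕ → ℚ
fraction (i , j) k = (i ⊖ j) ℚ./ suc k

rational : ℕ → ℚ
rational n = fraction (unpair (proj₁ (unpair n))) (proj₂ (unpair n))

rational-surjective : ∀ q → ∃ λ n → rational n ≡ q
rational-surjective q = let (i , j , e) = difference (ℚ.↥ q) in reach i j (ℚ.denominator-1 q) e refl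
  where
  difference : ∀ z → ∃₂ λ i j → i ⊖ j ≡ z
  difference (+ i)      = i , 0 , refl
  difference (-[1+ j ]) = 0 , suc j , refl

  reach : ∀ i j k → i ⊖ j ≡ ℚ.↥ q → k ≡ ℚ.denominator-1 q → ∃ λ n → rational n ≡ q
  reach i j k e refl =
    let (p , pe) = unpair-surjective i j
        (n , ne) = unpair-surjective p k
    in n , ≡.trans (≡.cong (λ u → fraction (unpair (proj₁ u)) (proj₂ u)) ne)
             (≡.trans (≡.cong (λ u → fraction u k) pe)
               (≡.trans (≡.cong (λ z → z ℚ./ suc k) e) (ℚₚ.↥p/↧p≡p q)))

-- Rational reals and open rays.

fromℚ : ℚ → ℝ
fromℚ q = record
  { lower     = ℚ._< q
  ; inhabited = q ℚ.- 1ℚ , ≡.subst (q ℚ.- 1ℚ ℚ.<_) (ℚₚ.+-identityʳ q)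
                  (ℚₚ.+-monoʳ-< q (ℚₚ.negative⁻¹ (ℚ.- 1ℚ)))
  ; proper    = q , ℚₚ.<-irrefl refl
  ; downward  = ℚₚ.<-trans
  ; no-max    = ℚₚ.<-dense
  }

fromℚ-positive : ∀ {q} → 0ℚ ℚ.< q → 0ℝ <ℝ fromℚ q
fromℚ-positive 0<q = 0ℚ , ℚₚ.<-irrefl refl , 0<q

lower-≤ : ∀ (x : ℝ) {q r} → q ℚ.≤ r → r ∈ lower x → q ∈ lower x
lower-≤ x {q} {r} q≤r r∈x with q ℚₚ.<? r
... | yes q<r = downward x q<r r∈x
... | no q≮r  = ≡.subst (_∈ lower x) (ℚₚ.≤-antisym (ℚₚ.≮⇒≥ q≮r) q≤r) r∈x

lower-<ℝ : ∀ (x : ℝ) {q r} → x <ℝ fromℚ r → q ∈ lower x → q ℚ.< r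
lower-<ℝ x {q} {r} (p , p∉x , p<r) q∈x with q ℚₚ.<? p
... | yes q<p = ℚₚ.<-trans q<p p<r
... | no q≮p  = contradiction (lower-≤ x (ℚₚ.≮⇒≥ q≮p) q∈x) p∉x

above-open : ∀ q → ℝ-Open (λ r → q ∈ lower r)
above-open q x q∈x with proper x
-- The set is an unbounded ray, but openness asks for a bounded interval; as `p` is not below `x`,
-- `p + 1` can be its right end.
... | p , p∉x = fromℚ q , fromℚ (p ℚ.+ 1ℚ)
  , (q , ℚₚ.<-irrefl refl , q∈x)
  , (p , p∉x , ≡.subst (ℚ._< p ℚ.+ 1ℚ) (ℚₚ.+-identityʳ p) (ℚₚ.+-monoʳ-< p (ℚₚ.positive⁻¹ 1ℚ)))
  , λ y (r , r≮q , r∈y) _ → lower-≤ y (ℚₚ.≮⇒≥ r≮q) r∈y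

-- Separating Borel sets in a Polish space.

module _ {S : Setoid a ℓ} {d : DistanceFunction (Setoid.Carrier S) ℝ}
         (isPolish : IsPolishMetric S d) where
  open Setoid S using (Carrier; _≈_)
  open IsPolishMetric isPolish
  open IsGeneralMetric isMetric using (nonNegative; 0⇒≈; triangle) renaming (sym to d-sym)

  beyond-open : ∀ q y → Metric-Open S d (λ x → q ∈ lower (d x y))
  beyond-open q y x q∈ with no-max (d x y) q∈
  -- With `q < r < d x y`, the triangle inequality keeps the points within `r - q` of `x` farther
  -- than `q` from `y`.
  ... | r , q<r , r∈ = fromℚ (r ℚ.- q) , fromℚ-positive 0<r-q , near
    where
    0<r-q : 0ℚ ℚ.< r ℚ.- q
    0<r-q = ≡.subst (ℚ._< r ℚ.- q) (ℚₚ.+-inverseʳ q) (ℚₚ.+-monoˡ-< (ℚ.- q) q<r)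

    near : ∀ z → d x z <ℝ fromℚ (r ℚ.- q) → q ∈ lower (d z y)
    near z xz<r-q with triangle x z y r∈
    ... | s , t , s∈ , t∈ , r≡s+t with q ℚₚ.≤? t
    ...   | yes q≤t = lower-≤ (d z y) q≤t t∈
    ...   | no q≰t = contradiction
      (ℚₚ.+-mono-< (lower-<ℝ (d x z) xz<r-q s∈) (ℚₚ.≰⇒> q≰t))
      (ℚₚ.<-irrefl (≡.trans (≡.sym r≡s+t) (≡.sym r-q+q)))
      where
      r-q+q : (r ℚ.- q) ℚ.+ q ≡ r
      r-q+q = ≡.trans (ℚₚ.+-assoc r (ℚ.- q) q)
        (≡.trans (≡.cong (r ℚ.+_) (ℚₚ.+-inverseˡ q)) (ℚₚ.+-identityʳ r))

  private
    dense : ℕ → Maybe Carrier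
    dense = proj₁ separable

  beyond : Maybe Carrier → ℚ → Pred Carrier 0ℓ
  beyond (just y) q x = q ∈ lower (d x y)
  beyond nothing  q x = ⊥

  -- Complements of closed balls about the points of the dense sequence, for all rational radii.
  separator : ℕ → Pred Carrier 0ℓ
  separator n = beyond (dense (proj₁ (unpair n))) (rational (proj₂ (unpair n)))

  separator-borel : ∀ n → Generated (Metric-Open S d) (separator n)
  separator-borel n = go (dense (proj₁ (unpair n)))
    where
    go : ∀ y → Generated (Metric-Open S d) (beyond y (rational (proj₂ (unpair n))))
    go (just y) = basic (beyond-open _ y)
    go nothing  = empty

  -- Points in the same separators have equal distances to all dense points. A dense point within
  -- `q / 2` of `x` is then as near to `y`, so no positive `q` lies below `d x y`.
  separator-separates : ∀ {x y} → (∀ n → separator n x ⇔ separator n y) → x ≈ y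
  separator-separates {x} {y} same = 0⇒≈ (negative , nonNegative {x} {y})
    where
    distances : ∀ {k z q} → dense k ≡ just z → q ∈ lower (d y z) → q ∈ lower (d x z)
    distances {k} {z} {q} eq q∈ with rational-surjective q
    ... | j , refl with unpair-surjective k j
    ...   | n , ne = ≡.subst (λ w → beyond w q x) eq (transport x (from (same n))
                       (≡.subst (λ w → beyond w q y) (≡.sym eq) q∈))
      where
      transport : ∀ x → (separator n y → separator n x) → beyond (dense k) q y → beyond (dense k) q x
      transport x f b rewrite ne = f b

    half : ∀ q → q ≡ ½ ℚ.* q ℚ.+ ½ ℚ.* q
    half q = ≡.trans (≡.sym (ℚₚ.*-identityˡ q)) (ℚₚ.*-distribʳ-+ q ½ ½)

    no-positive : ∀ {q} → 0ℚ ℚ.< q → q ∉ lower (d x y)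
    no-positive {q} 0<q q∈ with proj₂ separable x (fromℚ (½ ℚ.* q)) (fromℚ-positive 0<½q)
      where
      0<½q : 0ℚ ℚ.< ½ ℚ.* q
      0<½q = ≡.subst (ℚ._< ½ ℚ.* q) (ℚₚ.*-zeroʳ ½) (ℚₚ.*-monoʳ-<-pos ½ 0<q)
    ... | k , z , eq , xz< with triangle x z y q∈
    ...   | r , s , r∈ , s∈ , q≡r+s = ℚₚ.<-irrefl (≡.trans (≡.sym q≡r+s) (half q))
      (ℚₚ.+-mono-< (lower-<ℝ (d x z) xz< r∈)
        (lower-<ℝ (d x z) xz< (distances {k} eq (proj₁ (d-sym z y) s∈))))

    negative : ∀ {q} → q ∈ lower (d x y) → q ∈ lower 0ℝ
    negative {q} q∈ with q ℚₚ.<? 0ℚ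
    ... | yes q<0 = q<0
    ... | no q≮0 with no-max (d x y) q∈
    ...   | r , q<r , r∈ = contradiction r∈ (no-positive (ℚₚ.≤-<-trans (ℚₚ.≮⇒≥ q≮0) q<r))

-- The group action as a sequence of Borel maps.

section-measurable : (∀ {ℓ} → ExcludedMiddle ℓ) → (S : Setoid ℓ₂ ℓ) (M : MeasurableSpace a ℓ₁ m) →
  ∀ g {W} → MeasurableSpace.Measurable (discrete S ⊗ M) W →
  MeasurableSpace.Measurable M (λ x → W (g , x))
section-measurable em S M g = go
  where
  open MeasurableSpace M
  go : ∀ {W} → MeasurableSpace.Measurable (discrete S ⊗ M) W → Measurable (λ x → W (g , x))
  -- The section of a rectangle is its second side or empty, according to whether `g` lies in the
  -- first.
  go (basic (P , Q , mP , mQ , W⊆ , ⊆W)) with em {P = P g}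
  ... | yes p = extensional ((λ q → ⊆W (p , q)) , (λ w → proj₂ (W⊆ w))) mQ
  ... | no ¬p = extensional ((λ ()) , λ w → contradiction (proj₁ (W⊆ w)) ¬p) ∅-measurable
  go empty                = ∅-measurable
  go (compl w)            = ∁-measurable (go w)
  go (union w)            = ⋃-measurable λ n → go (w n)
  go (resp-≐ (f , g) w)   = extensional (f , g) (go w)

module _ {G : Group ℓ₂ ℓ} (enum : CountablyInfinite (Group.setoid G)) (X : BorelGSpace G a ℓ₁ m) where
  private
    module G = Group G
    open BorelGSpace X
    open Bijection enum renaming (to to γ) using (strictlySurjective)

    module X = Setoid setoid

    ·-cong : ∀ {g h x y} → g G.≈ h → x ≈ y → g · x ≈ h · y
    ·-cong e e′ = IsMeasurableMap.cong borel (e , e′)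

  enumeratedAction : EnumeratedAction setoid
  enumeratedAction = record
    { act      = λ i x → γ i · x
    ; act-cong = λ i → ·-cong G.refl
    ; comp     = λ i j → let (k , e) = strictlySurjective (γ i G.∙ γ j) in
                   k , λ x → X.sym (X.trans (·-cong e X.refl) (compat (γ i) (γ j) x))
    ; unit     = let (i , e) = strictlySurjective G.ε in
                   i , λ x → X.trans (·-cong e X.refl) (identity x)
    ; inv      = λ i → let (j , e) = strictlySurjective (γ i G.⁻¹) in
                   j , λ x → X.trans (·-cong e X.refl) (⁻¹-cancel (γ i) x)
    }
    where
    ⁻¹-cancel : ∀ g x → g G.⁻¹ · (g · x) ≈ x
    ⁻¹-cancel g x = X.trans (X.sym (compat (g G.⁻¹) g x))
      (X.trans (·-cong (G.inverseˡ g) X.refl) (identity x))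

  open EnumeratedAction enumeratedAction using (act)

  borel-algebra : (∀ {ℓ} → ExcludedMiddle ℓ) → IsInvariantσAlgebra act Measurable
  borel-algebra em = record
    { extensional = extensional
    ; ∅-closed    = ∅-measurable
    ; ∁-closed    = ∁-measurable
    ; ⋃-closed    = ⋃-measurable
    ; act-closed  = λ i mS → section-measurable em G.setoid space (γ i) (IsMeasurableMap.preimage borel mS)
    }

  orbit-act⁺ : ∀ {x y} → y ∈ orbit x → ∃ λ i → y ≈ act i x
  orbit-act⁺ (g , e) = let (i , e′) = strictlySurjective g in i , X.trans e (·-cong (G.sym e′) X.refl)

  -- Turns coordinates of names into membership in translates; measurability enters through
  -- `respects`.
  translate-act⁻¹ : ∀ i {P : Pred Carrier 0ℓ} → Measurable P →
    ∀ x → translate (γ i G.⁻¹) P x ⇔ P (act i x)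
  translate-act⁻¹ i mP x = mk⇔
    (λ (z , p , e) → respects mP (X.sym (X.trans (·-cong G.refl e)
      (X.trans (X.sym (compat (γ i) (γ i G.⁻¹) z)) (X.trans (·-cong (G.inverseʳ (γ i)) X.refl) (identity z))))) p)
    λ p → act i x , p , X.sym (X.trans (X.sym (compat (γ i G.⁻¹) (γ i) x))
      (X.trans (·-cong (G.inverseˡ (γ i)) X.refl) (identity x)))

-- The four Boolean combinations of two sets.

Holds : Fin 2 → Set → Set
Holds fzero        P = P
Holds (fsuc fzero) P = ¬ P

holds-unique : ∀ {P} i j → Holds i P → Holds j P → i ≡ j
holds-unique fzero        fzero        _  _  = refl
holds-unique fzero        (fsuc fzero) p  ¬p = contradiction p ¬p
holds-unique (fsuc fzero) fzero        ¬p p  = contradiction p ¬p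
holds-unique (fsuc fzero) (fsuc fzero) _  _  = refl

-- The index is read as two binary digits, one for `A` and one for `B`, with 0 standing for the set
-- and 1 for its complement.
quarters : {X : Set a} → Pred X 0ℓ → Pred X 0ℓ → Fin 4 → Pred X 0ℓ
quarters A B i x = Holds (quotient {2} 2 i) (A x) × Holds (remainder {2} 2 i) (B x)

module Quarters (em : ExcludedMiddle 0ℓ) {X : Set a} (A B : Pred X 0ℓ) where

  private
    holds-cover : ∀ P → ∃ λ i → Holds i P
    holds-cover P with em {P}
    ... | yes p = fzero , p
    ... | no ¬p = fsuc fzero , ¬p

    combine⁺ : ∀ i j x → Holds i (A x) → Holds j (B x) → quarters A B (combine i j) x
    combine⁺ i j x p q =
      ≡.subst (λ u → Holds (proj₁ u) (A x) × Holds (proj₂ u) (B x)) (≡.sym (remQuot-combine i j)) (p , q)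

    combine⁻ : ∀ i j x → quarters A B (combine i j) x → Holds i (A x) × Holds j (B x)
    combine⁻ i j x = ≡.subst (λ u → Holds (proj₁ u) (A x) × Holds (proj₂ u) (B x)) (remQuot-combine i j)

  quarters-cover : ∀ x → ∃ λ i → quarters A B i x
  quarters-cover x =
    let (i , p) = holds-cover (A x)
        (j , q) = holds-cover (B x)
    in combine i j , combine⁺ i j x p q

  quarters-disjoint : ∀ {i j x} → quarters A B i x → quarters A B j x → i ≡ j
  quarters-disjoint {i} {j} (p , q) (p′ , q′) =
    ≡.trans (≡.sym (combine-remQuot {2} 2 i))
      (≡.trans (≡.cong₂ combine (holds-unique (quotient {2} 2 i) (quotient {2} 2 j) p p′)
                                (holds-unique (remainder {2} 2 i) (remainder {2} 2 j) q q′))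
        (combine-remQuot {2} 2 j))

  quarters-determine : ∀ {x y} → (∀ i → quarters A B i x ⇔ quarters A B i y) → (A x ⇔ A y) × (B x ⇔ B y)
  quarters-determine {x} {y} e =
    mk⇔ (proj₁ (half x y λ i → to (e i))) (proj₁ (half y x λ i → from (e i))) ,
    mk⇔ (proj₂ (half x y λ i → to (e i))) (proj₂ (half y x λ i → from (e i)))
    where
    half : ∀ x y → (∀ i → quarters A B i x → quarters A B i y) → (A x → A y) × (B x → B y)
    half x y f =
      -- The quarter in `A` is completed by whichever side of `B` contains `x`.
      (λ p → let (j , q) = holds-cover (B x) in
        proj₁ (combine⁻ fzero j y (f (combine {2} {2} fzero j) (combine⁺ fzero j x p q)))) ,
      λ q → let (i , p) = holds-cover (A x) in
        proj₂ (combine⁻ i fzero y (f (combine {2} {2} i fzero) (combine⁺ i fzero x p q)))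

  quarters-closed : ∀ {act : ℕ → X → X} {𝓜 : Pred (Pred X 0ℓ) m} → IsInvariantσAlgebra act 𝓜 →
    𝓜 A → 𝓜 B → ∀ i → 𝓜 (quarters A B i)
  quarters-closed {𝓜 = 𝓜} σ A∈𝓜 B∈𝓜 i =
    ×-closed (holds-closed (quotient {2} 2 i) A∈𝓜) (holds-closed (remainder {2} 2 i) B∈𝓜)
    where
    open Closure em σ
    holds-closed : ∀ j {S} → 𝓜 S → 𝓜 (λ x → Holds j (S x))
    holds-closed fzero        mS = mS
    holds-closed (fsuc fzero) mS = ¬-closed mS

-- The partition for a smooth invariant relation.

module _ (em : ∀ {ℓ} → ExcludedMiddle ℓ) {c ℓ a ℓ₁ m} {G : Group c ℓ}
         (enum : CountablyInfinite (Group.setoid G)) (X : BorelGSpace G a ℓ₁ m) where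
  private
    module G = Group G
    open BorelGSpace X
    open Bijection enum renaming (to to γ) using ()
    open EnumeratedAction (enumeratedAction enum X) using (act)
    open Dynamics em setoid (enumeratedAction enum X) hiding (act-injective)

    σ : IsInvariantσAlgebra act Measurable
    σ = borel-algebra enum X em

  -- The translate by the inverse of `γ k` tests coordinate `k`. If none separated `x` from `y`,
  -- their translates would share all quarters and both names would agree.
  quarters-separate : ∀ {A B : Pred Carrier 0ℓ} → Measurable A → Measurable B → ∀ {x y} →
    ¬ (Agree (name A) x y × Agree (name B) x y) →
    ∃₂ λ g i → Separates (translate g (quarters A B i)) x y
  quarters-separate {A} {B} mA mB {x} {y} ¬agree = decidable-stable em λ ¬sep →
    ¬agree ((λ k → proj₁ (quarters-determine (same ¬sep k))) , λ k → proj₂ (quarters-determine (same ¬sep k)))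
    where
    open Quarters em A B

    mP : ∀ i → Measurable (quarters A B i)
    mP = quarters-closed σ mA mB

    same : ¬ (∃₂ λ g i → Separates (translate g (quarters A B i)) x y) →
           ∀ k i → quarters A B i (act k x) ⇔ quarters A B i (act k y)
    same ¬sep k i = mk⇔
      (λ p → decidable-stable em λ ¬p → ¬sep (γ k G.⁻¹ , i , inj₁
        (from (translate-act⁻¹ enum X k (mP i) x) p , ¬p ∘ to (translate-act⁻¹ enum X k (mP i) y))))
      (λ p → decidable-stable em λ ¬p → ¬sep (γ k G.⁻¹ , i , inj₂
        (¬p ∘ to (translate-act⁻¹ enum X k (mP i) x) , from (translate-act⁻¹ enum X k (mP i) y) p)))

  encode-borel : Aperiodic X → ∀ {b : Bits} (b-measurable : ∀ i → Measurable (b i))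
    (b-invariant : ∀ i → OrbitInvariant (b i)) → ∃₂ (Encoding σ {b} b-measurable b-invariant)
  encode-borel aperiodic {b} b-measurable b-invariant = encode σ {b} b-measurable b-invariant (separator isPolish)
    mU (λ n → respects (mU n)) (separator-separates isPolish) infinite
    where
    isPolish = proj₁ (proj₂ isStandardBorel)

    mU : ∀ n → Measurable (separator isPolish n)
    mU n = from (proj₂ (proj₂ isStandardBorel) (separator isPolish n)) (separator-borel isPolish n)

    infinite : ∀ x → ¬ Covered x (λ _ → ⊤)
    infinite x (covered-by xs c) = aperiodic x (xs , λ y y∈ →
      let (i , e) = orbit-act⁺ enum X {x} {y} y∈ in Any.map (Setoid.trans setoid e) (c i tt))

theorem8p12 : (∀ {ℓ} → ExcludedMiddle ℓ) →
    ∀ {c ℓ a ℓ₁ m e} (G : Group c ℓ) → CountablyInfinite (Group.setoid G) →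
    (X : BorelGSpace G a ℓ₁ m) → Aperiodic X →
    (E : Rel (BorelGSpace.Carrier X) e) → IsEquivalence E →
    Smooth (BorelGSpace.space X) E → Invariant X E →
    Σ (Fin 4 → Pred (BorelGSpace.Carrier X) 0ℓ) λ P →
    IsBorelPartition (BorelGSpace.space X) P ×
    (∀ x y → ¬ E x y → ∃₂ λ g i → Separates (BorelGSpace.translate X g (P i)) x y)
theorem8p12 em G enum X aperiodic E _ (h , h-measurable , E⇔h) invariant =
  partition (encode-borel em enum X aperiodic {b} b-measurable b-invariant)
  where
  open BorelGSpace X
  open Bijection enum renaming (to to γ) using ()
  open Dynamics em setoid (enumeratedAction enum X) using (OrbitInvariant; Bits; Encoding)

  -- A cut is determined by its rationals, so the bits of `h` are read along the enumeration of ℚ.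
  b : Bits
  b i x = rational i ∈ lower (h x)

  b-invariant : ∀ i → OrbitInvariant (b i)
  b-invariant i (k , e) = proj₁ (to (E⇔h _ _) (invariant (γ k , Setoid.sym setoid e)))

  b-measurable : ∀ i → Measurable (b i)
  b-measurable i = IsMeasurableMap.preimage h-measurable (basic (above-open (rational i)))

  h-equal : ∀ {x y} → (∀ i → b i x ⇔ b i y) → h x ≃ h y
  h-equal {x} {y} e = (λ {q} → forth q) , λ {q} → back q
    where
    forth : ∀ q → q ∈ lower (h x) → q ∈ lower (h y)
    forth q q∈ with rational-surjective q
    ... | i , refl = to (e i) q∈

    back : ∀ q → q ∈ lower (h y) → q ∈ lower (h x)
    back q q∈ with rational-surjective q
    ... | i , refl = from (e i) q∈

  partition : ∃₂ (Encoding (borel-algebra enum X em) {b} b-measurable b-invariant) →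
    Σ (Fin 4 → Pred Carrier 0ℓ) λ P → IsBorelPartition space P ×
      (∀ x y → ¬ E x y → ∃₂ λ g i → Separates (translate g (P i)) x y)
  partition (A , B , mA , mB , decode) = quarters A B , record
    { measurable = quarters-closed (borel-algebra enum X em) mA mB
    ; cover      = quarters-cover
    ; disjoint   = quarters-disjoint
    } , λ x y ¬Exy → quarters-separate em enum X mA mB λ (sA , sB) →
      ¬Exy (from (E⇔h x y) (h-equal (decode sA sB)))
    where open Quarters em A B
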